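{- There are no $\{2,3\}$-Diophantine quadruples.
   Context: For a finite set $S$ of primes, a positive integer is an $S$-unit if all its prime factors lie in $S$. A quadruple $(a_1,a_2,a_3,a_4)$ of positive, pairwise distinct integers is called an $S$-Diophantine quadruple if $a_ia_j+1$ is an $S$-unit for all $i\neq j$. -}

module Defs where

open import Data.Nat using (ℕ; _*_; _+_; _<_)
open import Data.Nat.Divisibility using (_∣_)
open import Data.Nat.Primality using (Prime)
open import Data.Fin using (Fin)
open import Data.Sum using (_⊎_)
open import Data.Product using (_×_)
open import Relation.Binary.PropositionalEquality using (_≡_; _≢_)

-- A finite set S of primes is represented as a predicate on ℕ.
-- n is an S-unit: n is positive and every prime factor of n lies in S.
IsSUnit : (ℕ → Set) → ℕ → Set
IsSUnit S n = (0 < n) × (∀ p → Prime p → p ∣ n → S p)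

S23 : ℕ → Set
S23 p = (p ≡ 2) ⊎ (p ≡ 3)

IsSDiophantineQuadruple : (ℕ → Set) → (Fin 4 → ℕ) → Set
IsSDiophantineQuadruple S a =
  (∀ i → 0 < a i) ×
  (∀ i j → i ≢ j → a i ≢ a j) ×
  (∀ i j → i ≢ j → IsSUnit S (a i * a j + 1))

{-# OPTIONS --safe #-}

-- Modulo 12 the six numbers xy + 1 must fall into a fixed pattern: for a suitable naming of
-- the entries, dx + 1 and yz + 1 are powers of 2, dy + 1 and xz + 1 are of the form 2·3^j, and
-- dz + 1 and xy + 1 are even.  The pattern is invariant under the Klein four-group, so d may be
-- taken maximal.  If g divides xd + 1 and zd + 1 then g divides x − z; applied to the 2-part and
-- the 3-part of zd + 1 this forces z to be minimal and zd < xy.  Call the entries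
-- a < b < c < d.  If g divides three of the numbers on a 4-cycle it divides the fourth, and this
-- determines enough exponents to give ad + 1 = q (ab + 1) and bc + 1 = q (ab + 1) r.  From there
-- ac + 1 = q (a² r + 1), with r a power of 2 and ac + 1 = 2·3^l (impossible by parity), or with
-- r a power of 3 and ac + 1 a power of 2 (modulo 8 only a = 1, r = 3 survives, which fails).

module Submission where

open import Defs
open import Data.Nat using (ℕ)
open import Data.Fin using (Fin)
open import Relation.Nullary using (¬_)

open import Data.Nat using (zero; suc; _+_; _*_; _^_; _∸_; _≤_; _<_; ∣_-_∣; z≤n; s≤s; NonZero; >-nonZero; ≢-nonZero; _%_; _≤?_; _≟_)
open import Data.Nat.Properties
open import Data.Nat.Divisibility using (_∣_; _∣?_; divides; quotient; m∣n⇒n≡m*quotient; ∣-trans; ∣-refl; ∣⇒≤; ∣1⇒≡1; _∣0; ∣m+n∣m⇒∣n; ∣m∣n⇒∣m+n; ∣m⇒∣m*n; ∣n⇒∣m*n; m∣m*n; n∣m*n; *-cancelˡ-∣; %-presˡ-∣; n∣m⇒m%n≡0; ∣n∣m%n⇒∣m)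
open import Data.Nat.DivMod using (m%n<n; %-distribˡ-*; %-distribˡ-+)
open import Data.Nat.Coprimality using (Coprime; coprime-divisor)
open import Data.Nat.Primality using (Prime; prime?; prime[2]; euclidsLemma)
open import Data.Nat.Primality.Factorisation using (PrimeFactorisation; factorise)
open import Data.Nat.ListAction using (product)
open import Data.Nat.Tactic.RingSolver using (solve-∀)
open import Data.Fin.Patterns using (0F; 1F; 2F; 3F)
open import Data.List using (List; []; _∷_)
open import Data.List.Membership.DecPropositional _≟_ using (_∈_; _∈?_)
open import Data.List.Relation.Unary.All using (All; []; _∷_)
open import Data.Product using (∃-syntax; _×_; _,_; proj₁; proj₂)
open import Data.Sum using (_⊎_; inj₁; inj₂; [_,_]′)
open import Data.Empty using (⊥)
open import Function using (_∘_)
open import Relation.Binary.Definitions using (tri<; tri≈; tri>)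
open import Relation.Binary.PropositionalEquality using (_≡_; _≢_; refl; sym; ≢-sym; trans; cong; cong₂; subst; subst₂; module ≡-Reasoning)
open import Relation.Nullary using (Dec; yes; no; contradiction)
open import Relation.Nullary.Decidable using (from-yes; from-no; _×-dec_; _⊎-dec_; _→-dec_; ¬?)

-- Numbers of the form 2^i·3^j.

-- Opaque so that the exponents can be inferred from unit i j by unification.
opaque
  unit : ℕ → ℕ → ℕ
  unit i j = 2 ^ i * 3 ^ j

  unit-* : ∀ i j i′ j′ → unit i j * unit i′ j′ ≡ unit (i + i′) (j + j′)
  unit-* i j i′ j′ = begin
    2 ^ i * 3 ^ j * (2 ^ i′ * 3 ^ j′)     ≡⟨ interchange (2 ^ i) (3 ^ j) (2 ^ i′) (3 ^ j′) ⟩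
    2 ^ i * 2 ^ i′ * (3 ^ j * 3 ^ j′)     ≡⟨ cong₂ _*_ (^-distribˡ-+-* 2 i i′) (^-distribˡ-+-* 3 j j′) ⟨
    unit (i + i′) (j + j′)                ∎
    where
    open ≡-Reasoning
    interchange : ∀ a b c d → a * b * (c * d) ≡ a * c * (b * d)
    interchange = solve-∀

  unit≢0 : ∀ i j → NonZero (unit i j)
  unit≢0 i j = m*n≢0 (2 ^ i) (3 ^ j) {{m^n≢0 2 i}} {{m^n≢0 3 j}}

  unit≡2^ : ∀ i → unit i 0 ≡ 2 ^ i
  unit≡2^ i = *-identityʳ (2 ^ i)

  unit≡3^ : ∀ j → unit 0 j ≡ 3 ^ j
  unit≡3^ j = *-identityˡ (3 ^ j)

  unit≡2^*3^ : ∀ i j → unit i j ≡ 2 ^ i * 3 ^ j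
  unit≡2^*3^ i j = refl

2∣unit : ∀ {i} j → 1 ≤ i → 2 ∣ unit i j
2∣unit j (s≤s {n = i} z≤n) = subst (2 ∣_) (sym (unit≡2^*3^ (suc i) j)) (∣m⇒∣m*n (3 ^ j) (m∣m*n (2 ^ i)))

SUnit⇒unit : ∀ {n} → IsSUnit S23 n → ∃[ i ] ∃[ j ] n ≡ unit i j
SUnit⇒unit {n} (n>0 , p∈S) =
  let i , j , eq = go factors factorsPrime (λ p pr p∣ → p∈S p pr (subst (p ∣_) (sym isFactorisation) p∣))
  in  i , j , trans isFactorisation eq
  where
  open PrimeFactorisation (factorise n {{>-nonZero n>0}})
  go : ∀ ps → All Prime ps → (∀ p → Prime p → p ∣ product ps → S23 p) → ∃[ i ] ∃[ j ] product ps ≡ unit i j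
  go [] [] _ = 0 , 0 , sym (unit≡2^ 0)
  go (p ∷ ps) (pr ∷ prs) S∋ with go ps prs (λ q qr q∣ → S∋ q qr (∣n⇒∣m*n p q∣)) | S∋ p pr (m∣m*n (product ps))
  ... | i , j , eq | inj₁ refl = suc i , j , trans (cong₂ _*_ (sym (unit≡2^ 1)) eq) (unit-* 1 0 i j)
  ... | i , j , eq | inj₂ refl = i , suc j , trans (cong₂ _*_ (sym (unit≡3^ 1)) eq) (unit-* 0 1 i j)

unit-mono-∣ : ∀ {i j i′ j′} → i ≤ i′ → j ≤ j′ → unit i j ∣ unit i′ j′
unit-mono-∣ {i} {j} i≤i′ j≤j′ with m≤n⇒∃[o]m+o≡n i≤i′ | m≤n⇒∃[o]m+o≡n j≤j′
... | k , refl | l , refl = subst (unit i j ∣_) (unit-* i j k l) (m∣m*n (unit k l))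

prime∣^⇒∣ : ∀ {p} b n → Prime p → p ∣ b ^ n → p ∣ b
prime∣^⇒∣ b zero    pr p∣1 = subst (_∣ b) (sym (∣1⇒≡1 p∣1)) (divides b (sym (*-identityʳ b)))
prime∣^⇒∣ b (suc n) pr p∣  = [ (λ p∣b → p∣b) , prime∣^⇒∣ b n pr ]′ (euclidsLemma b (b ^ n) pr p∣)

prime[3] : Prime 3
prime[3] = from-yes (prime? 3)

2∤3^ : ∀ n → ¬ 2 ∣ 3 ^ n
2∤3^ n = from-no (2 ∣? 3) ∘ prime∣^⇒∣ 3 n prime[2]

3∤2^ : ∀ n → ¬ 3 ∣ 2 ^ n
3∤2^ n = from-no (3 ∣? 2) ∘ prime∣^⇒∣ 2 n prime[3]

-- If m < i, then 2^(m+1) divides 2^m·3^n, and cancelling 2^m leaves 2 ∣ 3^n.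
unit∣⇒≤₂ : ∀ {i j m n} → unit i j ∣ unit m n → i ≤ m
unit∣⇒≤₂ {i} {j} {m} {n} d∣ = ≮⇒≥ λ m<i → 2∤3^ n (subst (2 ∣_) (unit≡3^ n)
  (∣-trans (2∣unit 0 ≤-refl) (*-cancelˡ-∣ (unit m 0) {{unit≢0 m 0}}
    (subst₂ _∣_ (sym (unit-* m 0 1 0)) (sym (trans (unit-* m 0 0 n) (cong₂ unit (+-identityʳ m) refl)))
      (∣-trans (unit-mono-∣ (subst (_≤ i) (+-comm 1 m) m<i) z≤n) d∣)))))

unit∣⇒≤₃ : ∀ {i j m n} → unit i j ∣ unit m n → j ≤ n
unit∣⇒≤₃ {i} {j} {m} {n} d∣ = ≮⇒≥ λ n<j → 3∤2^ m (subst (3 ∣_) (unit≡2^ m)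
  (subst (_∣ unit m 0) (unit≡3^ 1) (*-cancelˡ-∣ (unit 0 n) {{unit≢0 0 n}}
    (subst₂ _∣_ (sym (unit-* 0 n 0 1)) (sym (trans (unit-* 0 n m 0) (cong₂ unit refl (+-identityʳ n))))
      (∣-trans (unit-mono-∣ z≤n (subst (_≤ j) (+-comm 1 n) n<j)) d∣)))))

-- Common divisors of numbers xy + 1.

coprime-*+1 : ∀ {g} x z → g ∣ x * z + 1 → Coprime g z
coprime-*+1 x z g∣ (k∣g , k∣z) = ∣1⇒≡1 (∣m+n∣m⇒∣n (∣-trans k∣g g∣) (∣n⇒∣m*n x k∣z))

-- g divides the difference (y - x) z and is coprime to z.
∣-∸ : ∀ {g x y} z → x ≤ y → g ∣ x * z + 1 → g ∣ y * z + 1 → g ∣ y ∸ x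
∣-∸ {g} {x} z x≤y g∣xz g∣yz with m≤n⇒∃[o]m+o≡n x≤y
... | t , refl = subst (g ∣_) (sym (m+n∸m≡n x t))
  (coprime-divisor (coprime-*+1 x z g∣xz) (∣m+n∣m⇒∣n (subst (g ∣_) (expand x t z) g∣yz) g∣xz))
  where
  expand : ∀ x t z → (x + t) * z + 1 ≡ x * z + 1 + z * t
  expand = solve-∀

∣-dist : ∀ {g} x y z → g ∣ x * z + 1 → g ∣ y * z + 1 → g ∣ ∣ x - y ∣
∣-dist {g} x y z g∣xz g∣yz with ≤-total x y
... | inj₁ x≤y = subst (g ∣_) (sym (m≤n⇒∣m-n∣≡n∸m x≤y)) (∣-∸ z x≤y g∣xz g∣yz)
... | inj₂ y≤x = subst (g ∣_) (sym (m≤n⇒∣n-m∣≡n∸m y≤x)) (∣-∸ z y≤x g∣yz g∣xz)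

-- Modulo g, xz ≡ yz ≡ yw ≡ -1, and (xw)(yz) = (xz)(yw) then gives xw ≡ -1; `identity` says this
-- without subtraction. Consequently the least exponent of a prime on a 4-cycle occurs at least
-- twice.
∣-rectangle : ∀ {g} x y z w → g ∣ x * z + 1 → g ∣ y * z + 1 → g ∣ y * w + 1 → g ∣ x * w + 1
∣-rectangle {g} x y z w g∣xz g∣yz g∣yw =
  ∣m+n∣m⇒∣n
    (subst (g ∣_) (identity x y z w)
      (∣m∣n⇒∣m+n (∣m∣n⇒∣m+n (∣n⇒∣m*n (x * w) g∣yz) g∣xz) g∣yw))
    (∣m⇒∣m*n (y * w + 1) g∣xz)
  where
  identity : ∀ x y z w → x * w * (y * z + 1) + (x * z + 1) + (y * w + 1) ≡ (x * z + 1) * (y * w + 1) + (x * w + 1)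
  identity = solve-∀

∣x-y∣<z : ∀ {x y z} → x < z → y < z → ∣ x - y ∣ < z
∣x-y∣<z {x} {y} x<z y<z = ≤-<-trans (∣m-n∣≤m⊔n x y) (⊔-lub x<z y<z)

∣∧<⇒≡ : ∀ {g x y} → g ∣ ∣ x - y ∣ → ∣ x - y ∣ < g → x ≡ y
∣∧<⇒≡ {g} {x} {y} g∣ <g with ∣ x - y ∣ in eq
... | zero  = ∣m-n∣≡0⇒m≡n eq
... | suc t = contradiction (∣⇒≤ g∣) (<⇒≱ <g)

-- Rigidity of quadruples with ad + 1 = q (ab + 1) and bc + 1 = q (ab + 1) r.

-- The contradictions start from `ac+1≡`; the other equations settle the exceptional case a = 1, r =
-- 3.
record Rigid (a b c d q r : ℕ) : Set where
  field
    e : ℕ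
    q≡ : q ≡ a * e + 1
    d≡ : d ≡ q * b + e
    qr≡ : q * r ≡ b * e + 1
    ac+1≡ : a * c + 1 ≡ q * (a * a * r + 1)

-- Write c = a + (ab + 1) C and d = q b + e.  Both e and C are smaller than q, and both satisfy
-- b t ≡ −1 modulo q, so e = C.
rigid : ∀ {a b c d q r} → 0 < a → a ≤ c → c < d →
        a * d + 1 ≡ q * (a * b + 1) → b * c + 1 ≡ q * (a * b + 1) * r → q ∣ b * d + 1 →
        Rigid a b c d q r
rigid {a} {b} {c} {d} {q} {r} a>0 a≤c c<d ad bc q∣bd = record
  { e = e ; q≡ = q≡ ; d≡ = d≡ ; qr≡ = trans (sym bC≡) (cong (λ x → b * x + 1) (sym e≡C)) ; ac+1≡ = ac≡ }
  where
  P = a * b + 1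
  instance
    P≢0 : NonZero P
    P≢0 = >-nonZero (m≤n+m 1 (a * b))

  P∣c∸a : P ∣ c ∸ a
  P∣c∸a = ∣-∸ b a≤c ∣-refl
    (subst (P ∣_) (trans (sym bc) (cong (_+ 1) (*-comm b c))) (∣m⇒∣m*n r (n∣m*n q)))

  C = quotient P∣c∸a

  c≡ : c ≡ a + P * C
  c≡ = trans (sym (m+[n∸m]≡n a≤c))
             (cong (a +_) (m∣n⇒n≡m*quotient P∣c∸a))

  bC≡ : b * C + 1 ≡ q * r
  bC≡ = *-cancelˡ-≡ _ _ P (begin
    P * (b * C + 1)      ≡⟨ lem a b C ⟩
    b * (a + P * C) + 1  ≡⟨ cong (λ x → b * x + 1) c≡ ⟨
    b * c + 1            ≡⟨ bc ⟩
    q * P * r            ≡⟨ lem₂ q P r ⟩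
    P * (q * r)          ∎)
    where
    open ≡-Reasoning
    lem : ∀ a b C → (a * b + 1) * (b * C + 1) ≡ b * (a + (a * b + 1) * C) + 1
    lem = solve-∀
    lem₂ : ∀ q P r → q * P * r ≡ P * (q * r)
    lem₂ = solve-∀

  qP≡ : a * d + 1 ≡ a * (q * b) + q
  qP≡ = trans ad (lem a b q)
    where
    lem : ∀ a b q → q * (a * b + 1) ≡ a * (q * b) + q
    lem = solve-∀

  -- Otherwise ad + 1 ≤ a (d + 1) ≤ aqb < aqb + q = ad + 1.
  qb≤d : q * b ≤ d
  qb≤d = ≮⇒≥ λ d<qb → n≮n (a * d + 1) (begin-strict
    a * d + 1         ≤⟨ +-monoʳ-≤ (a * d) a>0 ⟩
    a * d + a         ≡⟨ trans (+-comm (a * d) a) (sym (*-suc a d)) ⟩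
    a * suc d         ≤⟨ *-monoʳ-≤ a d<qb ⟩
    a * (q * b)       <⟨ m<m+n (a * (q * b)) q>0 ⟩
    a * (q * b) + q   ≡⟨ qP≡ ⟨
    a * d + 1         ∎)
    where
    open ≤-Reasoning
    q>0 : 0 < q
    q>0 = n≢0⇒n>0 λ { refl → m+1+n≢0 (a * d) ad }

  e = d ∸ q * b

  d≡ : d ≡ q * b + e
  d≡ = sym (m+[n∸m]≡n qb≤d)

  q≡ : q ≡ a * e + 1
  q≡ = +-cancelˡ-≡ (a * (q * b)) _ _ (begin
    a * (q * b) + q            ≡⟨ qP≡ ⟨
    a * d + 1                  ≡⟨ cong (λ x → a * x + 1) d≡ ⟩
    a * (q * b + e) + 1        ≡⟨ lem a (q * b) e ⟩
    a * (q * b) + (a * e + 1)  ∎)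
    where
    open ≡-Reasoning
    lem : ∀ a x e → a * (x + e) + 1 ≡ a * x + (a * e + 1)
    lem = solve-∀

  e<q : e < q
  e<q = begin-strict
    e          ≤⟨ m≤n*m e a {{>-nonZero a>0}} ⟩
    a * e      <⟨ m<m+n (a * e) (s≤s z≤n) ⟩
    a * e + 1  ≡⟨ q≡ ⟨
    q          ∎
    where open ≤-Reasoning

  -- If q ≤ C, then d = qb + e ≤ (b + 1) q ≤ PC ≤ c, against c < d.
  C<q : C < q
  C<q = ≰⇒> λ q≤C → <⇒≱ c<d (begin
    d              ≡⟨ d≡ ⟩
    q * b + e      ≤⟨ +-monoʳ-≤ (q * b) (<⇒≤ e<q) ⟩
    q * b + q      ≡⟨ lem q b ⟩
    (1 * b + 1) * q ≤⟨ *-mono-≤ (+-monoˡ-≤ 1 (*-monoˡ-≤ b a>0)) q≤C ⟩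
    P * C          ≤⟨ m≤n+m (P * C) a ⟩
    a + P * C      ≡⟨ c≡ ⟨
    c              ∎)
    where
    open ≤-Reasoning
    lem : ∀ q b → q * b + q ≡ (1 * b + 1) * q
    lem = solve-∀

  q∣eb : q ∣ e * b + 1
  q∣eb = ∣m+n∣m⇒∣n (subst (q ∣_) (trans (cong (λ x → b * x + 1) d≡) (lem b q e)) q∣bd) (m∣m*n (b * b))
    where
    lem : ∀ b q e → b * (q * b + e) + 1 ≡ q * (b * b) + (e * b + 1)
    lem = solve-∀

  e≡C : e ≡ C
  e≡C = ∣∧<⇒≡
    (∣-dist e C b q∣eb (subst (q ∣_) (trans (sym bC≡) (cong (_+ 1) (*-comm b C))) (m∣m*n r)))
    (∣x-y∣<z e<q C<q)

  -- ac + 1 splits as a² (bC + 1) + (aC + 1), where bC + 1 = qr and aC + 1 = ae + 1 = q.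
  ac≡ : a * c + 1 ≡ q * (a * a * r + 1)
  ac≡ = begin
    a * c + 1                          ≡⟨ cong (λ x → a * x + 1) c≡ ⟩
    a * (a + P * C) + 1                ≡⟨ lem a b C ⟩
    a * a * (b * C + 1) + (a * C + 1)  ≡⟨ cong₂ (λ x y → a * a * x + y) bC≡ (trans (cong (λ x → a * x + 1) (sym e≡C)) (sym q≡)) ⟩
    a * a * (q * r) + q                ≡⟨ lem₂ a q r ⟩
    q * (a * a * r + 1)                ∎
    where
    open ≡-Reasoning
    lem : ∀ a b C → a * (a + (a * b + 1) * C) + 1 ≡ a * a * (b * C + 1) + (a * C + 1)
    lem = solve-∀
    lem₂ : ∀ a q r → a * a * (q * r) + q ≡ q * (a * a * r + 1)
    lem₂ = solve-∀

-- Pairs of entries as edges, and the exponents of xy + 1.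

unit∣edge : ∀ x y {i j i′ j′} → x * y + 1 ≡ unit i j → i′ ≤ i → j′ ≤ j → unit i′ j′ ∣ x * y + 1
unit∣edge x y {i′ = i′} {j′} eq i′≤i j′≤j = subst (unit i′ j′ ∣_) (sym eq) (unit-mono-∣ i′≤i j′≤j)

edge-sym : ∀ x y {n} → x * y + 1 ≡ n → y * x + 1 ≡ n
edge-sym x y = trans (cong (_+ 1) (*-comm y x))

unit-mono-≤ : ∀ {i j i′ j′} → i ≤ i′ → j ≤ j′ → unit i j ≤ unit i′ j′
unit-mono-≤ {i′ = i′} {j′} i≤i′ j≤j′ = ∣⇒≤ {{unit≢0 i′ j′}} (unit-mono-∣ i≤i′ j≤j′)

-- Bounding both exponents would give c < ac + 1 ≤ `unit i′ j′` < b < c. This serves to push an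
-- exponent of ac + 1 above that of ad + 1.
edge-large : ∀ {a b c i j i′ j′} → 0 < a → b < c → a * c + 1 ≡ unit i j → unit i′ j′ < b →
             ¬ (i ≤ i′ × j ≤ j′)
edge-large {a} {b} {c} {i} {j} {i′} {j′} a>0 b<c ac u<b (i≤ , j≤) = n≮n c (begin-strict
  c           ≤⟨ m≤n*m c a {{>-nonZero a>0}} ⟩
  a * c       ≤⟨ m≤m+n (a * c) 1 ⟩
  a * c + 1   ≡⟨ ac ⟩
  unit i j    ≤⟨ unit-mono-≤ i≤ j≤ ⟩
  unit i′ j′  <⟨ u<b ⟩
  b           <⟨ b<c ⟩
  c           ∎)
  where open ≤-Reasoning

-- The case bd + 1 = 2·3^k.

-- The exponents found below make `rigid` applicable with q = 3^n and r an even power of 2. Then ac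
-- + 1 = 3^n (a² r + 1) is odd, whereas ac + 1 = 2·3^l.
no-bd-pure₃ : ∀ {a b c d x y k l m n u v} → 0 < a → a < c → b < c → c < d →
            c * d + 1 ≡ unit y 0 → a * b + 1 ≡ unit x 0 →
            b * d + 1 ≡ unit 1 k → a * c + 1 ≡ unit 1 l →
            a * d + 1 ≡ unit (suc m) n → b * c + 1 ≡ unit (suc u) v →
            suc m < y → n < k → unit 1 n < b → a * d < b * c → ⊥
no-bd-pure₃ {a} {b} {c} {d} {x} {y} {k} {l} {m} {n} {u} {v} a>0 a<c b<c c<d cd ab bd ac ad bc m<y n<k n<b ad<bc =
  [ 2∤3^ n ∘ subst (2 ∣_) (unit≡3^ n) , 2∤odd ]′
    (euclidsLemma (unit 0 n) (a * a * r + 1) prime[2] (subst (2 ∣_) (trans (sym ac) ac+1≡) (2∣unit l ≤-refl)))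
  where
  n<l : n < l
  n<l = ≰⇒> λ l≤n → edge-large a>0 b<c ac n<b (≤-refl , l≤n)

  -- On the cycle a, c, b, d the exponent n of 3 in ad + 1 lies below k and l, so the fourth edge bc
  -- has it too.
  v≡n : v ≡ n
  v≡n = ≤-antisym
    (≮⇒≥ λ n<v → n≮n n (unit∣⇒≤₃ (subst (unit 0 (suc n) ∣_) ad
      (∣-rectangle a b c d (unit∣edge a c ac z≤n n<l) (unit∣edge b c bc z≤n n<v) (unit∣edge b d bd z≤n n<k)))))
    (unit∣⇒≤₃ (subst (unit 0 n ∣_) bc
      (∣-rectangle b a d c (unit∣edge b d bd z≤n (<⇒≤ n<k)) (unit∣edge a d ad z≤n ≤-refl) (unit∣edge a c ac z≤n (<⇒≤ n<l)))))

  -- The 3-parts agree and ad + 1 < bc + 1, so the difference lies in the 2-part.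
  m<u : suc m < suc u
  m<u = ≰⇒> λ u≤m → <⇒≱ (+-monoˡ-< 1 ad<bc)
    (subst (_≤ a * d + 1) (sym bc) (subst (unit (suc u) v ≤_) (sym ad) (unit-mono-≤ u≤m (≤-reflexive v≡n))))

  cb = edge-sym b c bc

  -- The same argument for the prime 2 on the cycle a, b, c, d.
  x≡m : x ≡ suc m
  x≡m = ≤-antisym
    (≮⇒≥ λ m<x → n≮n (suc m) (unit∣⇒≤₂ (subst (unit (suc (suc m)) 0 ∣_) ad
      (∣-rectangle a c b d (unit∣edge a b ab m<x z≤n) (unit∣edge c b cb m<u z≤n) (unit∣edge c d cd m<y z≤n)))))
    (unit∣⇒≤₂ (subst (unit (suc m) 0 ∣_) ab
      (∣-rectangle a c d b (unit∣edge a d ad ≤-refl z≤n) (unit∣edge c d cd (<⇒≤ m<y) z≤n) (unit∣edge c b cb (<⇒≤ m<u) z≤n))))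

  w+ : ∃[ w ] suc (suc m) + w ≡ suc u
  w+ = m≤n⇒∃[o]m+o≡n m<u
  w = proj₁ w+
  r = unit (suc w) 0

  ad≡ : a * d + 1 ≡ unit 0 n * (a * b + 1)
  ad≡ = begin
    a * d + 1                     ≡⟨ ad ⟩
    unit (suc m) n                ≡⟨ cong₂ unit refl (+-identityʳ n) ⟨
    unit (suc m) (n + 0)          ≡⟨ unit-* 0 n (suc m) 0 ⟨
    unit 0 n * unit (suc m) 0     ≡⟨ cong (λ t → unit 0 n * unit t 0) x≡m ⟨
    unit 0 n * unit x 0           ≡⟨ cong (unit 0 n *_) ab ⟨
    unit 0 n * (a * b + 1)        ∎
    where open ≡-Reasoning

  bc≡ : b * c + 1 ≡ unit 0 n * (a * b + 1) * r
  bc≡ = begin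
    b * c + 1                       ≡⟨ bc ⟩
    unit (suc u) v                  ≡⟨ cong₂ unit (trans (sym (proj₂ w+)) (sym (+-suc (suc m) w))) (trans v≡n (sym (+-identityʳ n))) ⟩
    unit (suc m + suc w) (n + 0)    ≡⟨ unit-* (suc m) n (suc w) 0 ⟨
    unit (suc m) n * r              ≡⟨ cong (_* r) (trans (sym ad) ad≡) ⟩
    unit 0 n * (a * b + 1) * r      ∎
    where open ≡-Reasoning

  open Rigid (rigid a>0 (<⇒≤ a<c) c<d ad≡ bc≡ (unit∣edge b d bd z≤n (<⇒≤ n<k)))

  2∤odd : ¬ 2 ∣ a * a * r + 1
  2∤odd 2∣ = from-no (2 ∣? 1) (∣m+n∣m⇒∣n 2∣ (∣n⇒∣m*n (a * a) (2∣unit 0 (s≤s z≤n))))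

-- When a²·3^w + 1 is a power of 2.

-- Contains the squares modulo 8 and is closed under multiplication by 3, but misses −1.
residues : List ℕ
residues = 0 ∷ 1 ∷ 3 ∷ 4 ∷ []

squares×3^-mod8 : ∀ a w → (a * a * 3 ^ w) % 8 ∈ residues
squares×3^-mod8 a zero = subst (_∈ residues) (sym (trans (cong (_% 8) (*-identityʳ (a * a))) (%-distribˡ-* a a 8)))
  (from-yes (allUpTo? (λ s → (s * s) % 8 ∈? residues) 8) (m%n<n a 8))
squares×3^-mod8 a (suc w) = subst (_∈ residues) (sym (trans (cong (_% 8) (lem (a * a) (3 ^ w))) (%-distribˡ-* s 3 8)))
  (from-yes (allUpTo? (λ t → (t ∈? residues) →-dec ((t * 3) % 8 ∈? residues)) 8)
    (m%n<n s 8) (squares×3^-mod8 a w))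
  where
  s = a * a * 3 ^ w
  lem : ∀ x y → x * (3 * y) ≡ x * y * 3
  lem = solve-∀

8∤a²3^w+1 : ∀ a w → ¬ 8 ∣ a * a * 3 ^ w + 1
8∤a²3^w+1 a w 8∣ = from-yes (allUpTo? (λ t → (t ∈? residues) →-dec ¬? ((t + 1) % 8 ≟ 0)) 8)
  (m%n<n s 8) (squares×3^-mod8 a w) (trans (sym (%-distribˡ-+ s 1 8)) (n∣m⇒m%n≡0 (s + 1) 8 8∣))
  where s = a * a * 3 ^ w

-- The solutions are (b , e) = (5 , 1) and (4 , 2), since e must divide 2.
exceptional : ∀ b e → (e + 1) * 3 ≡ b * e + 1 →
              b * ((e + 1) * b + e) + 1 ≡ 56 ⊎ b * ((e + 1) * b + e) + 1 ≡ 57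
exceptional b e eq = go e (∣⇒≤ e∣2) eq
  where
  3e+2≡ : ∀ e → (e + 1) * 3 ≡ 3 * e + 2 + 1
  3e+2≡ = solve-∀
  e∣2 : e ∣ 2
  e∣2 = ∣m+n∣m⇒∣n (divides b (+-cancelʳ-≡ 1 _ _ (trans (sym (3e+2≡ e)) eq))) (n∣m*n 3)
  go : ∀ e → e ≤ 2 → (e + 1) * 3 ≡ b * e + 1 →
       b * ((e + 1) * b + e) + 1 ≡ 56 ⊎ b * ((e + 1) * b + e) + 1 ≡ 57
  go 0 _ eq = contradiction (trans eq (cong (_+ 1) (*-zeroʳ b))) λ ()
  go 1 _ eq = inj₁ (cong (λ b → b * (2 * b + 1) + 1) (*-cancelʳ-≡ b 5 1 (sym (+-cancelʳ-≡ 1 5 _ eq))))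
  go 2 _ eq = inj₂ (cong (λ b → b * (3 * b + 2) + 1) (*-cancelʳ-≡ b 4 2 (sym (+-cancelʳ-≡ 1 8 _ eq))))
  go (suc (suc (suc _))) (s≤s (s≤s ())) _

-- 56 = 7·8 and 57 = 3·19 each have an odd prime factor.
2^≢56,57 : ∀ {N} y → N ≡ unit y 0 → N ≡ 56 ⊎ N ≡ 57 → ⊥
2^≢56,57 y eq (inj₁ N≡) = from-no (7 ∣? 2) (prime∣^⇒∣ 2 y (from-yes (prime? 7))
  (subst (7 ∣_) (trans (sym N≡) (trans eq (unit≡2^ y))) (divides 8 refl)))
2^≢56,57 y eq (inj₂ N≡) = 3∤2^ y
  (subst (3 ∣_) (trans (sym N≡) (trans eq (unit≡2^ y))) (divides 19 refl))

a²r≡3 : ∀ a w → a * a * unit 0 (suc w) ≡ 3 → a ≡ 1 × unit 0 (suc w) ≡ 3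
a²r≡3 a w eq = m*n≡1⇒m≡1 a a (m*n≡1⇒m≡1 (a * a) s a²s≡1) ,
               trans (sym 3s≡r) (cong (3 *_) (m*n≡1⇒n≡1 (a * a) s a²s≡1))
  where
  s = unit 0 w
  3s≡r : 3 * s ≡ unit 0 (suc w)
  3s≡r = trans (cong (_* s) (sym (unit≡3^ 1))) (unit-* 0 1 0 w)
  lem : ∀ x s → 3 * (x * s) ≡ x * (3 * s)
  lem = solve-∀
  a²s≡1 : a * a * s ≡ 1
  a²s≡1 = *-cancelˡ-≡ _ 1 3 (trans (lem (a * a) s) (trans (cong (a * a *_) 3s≡r) eq))

-- The case bd + 1 = 2^y.

-- The roles of 2 and 3 are exchanged. Now q = 2^m rather than 2^(m+1), because ab + 1 = 2·3^n
-- already contains one factor 2, and r is a power of 3.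
no-bd-pure₂ : ∀ {a b c d x y k l m n u v} → 0 < a → a < c → b < c → c < d →
           b * d + 1 ≡ unit y 0 → a * c + 1 ≡ unit x 0 →
           c * d + 1 ≡ unit 1 k → a * b + 1 ≡ unit 1 l →
           a * d + 1 ≡ unit (suc m) n → b * c + 1 ≡ unit (suc u) v →
           suc m < y → n < k → unit (suc m) 0 < b → a * d < b * c → ⊥
no-bd-pure₂ {a} {b} {c} {d} {x} {y} {k} {l} {m} {n} {u} {v} a>0 a<c b<c c<d bd ac cd ab ad bc m<y n<k m<b ad<bc =
  finish (proj₁ j+) a²r+1≡
  where
  m<x : suc m < x
  m<x = ≰⇒> λ x≤m → edge-large a>0 b<c ac m<b (x≤m , z≤n)

  u≡m : suc u ≡ suc m
  u≡m = ≤-antisym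
    (≮⇒≥ λ m<u → n≮n (suc m) (unit∣⇒≤₂ (subst (unit (suc (suc m)) 0 ∣_) ad
      (∣-rectangle a b c d (unit∣edge a c ac m<x z≤n) (unit∣edge b c bc m<u z≤n) (unit∣edge b d bd m<y z≤n)))))
    (unit∣⇒≤₂ (subst (unit (suc m) 0 ∣_) bc
      (∣-rectangle b a d c (unit∣edge b d bd (<⇒≤ m<y) z≤n) (unit∣edge a d ad ≤-refl z≤n) (unit∣edge a c ac (<⇒≤ m<x) z≤n))))

  n<v : n < v
  n<v = ≰⇒> λ v≤n → <⇒≱ (+-monoˡ-< 1 ad<bc)
    (subst (_≤ a * d + 1) (sym bc) (subst (unit (suc u) v ≤_) (sym ad) (unit-mono-≤ (≤-reflexive u≡m) v≤n)))

  cb = edge-sym b c bc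

  l≡n : l ≡ n
  l≡n = ≤-antisym
    (≮⇒≥ λ n<l → n≮n n (unit∣⇒≤₃ (subst (unit 0 (suc n) ∣_) ad
      (∣-rectangle a c b d (unit∣edge a b ab z≤n n<l) (unit∣edge c b cb z≤n n<v) (unit∣edge c d cd z≤n n<k)))))
    (unit∣⇒≤₃ (subst (unit 0 n ∣_) ab
      (∣-rectangle a c d b (unit∣edge a d ad z≤n ≤-refl) (unit∣edge c d cd z≤n (<⇒≤ n<k)) (unit∣edge c b cb z≤n (<⇒≤ n<v)))))

  w+ : ∃[ w ] suc n + w ≡ v
  w+ = m≤n⇒∃[o]m+o≡n n<v
  w = proj₁ w+
  r = unit 0 (suc w)

  ad≡ : a * d + 1 ≡ unit m 0 * (a * b + 1)
  ad≡ = begin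
    a * d + 1               ≡⟨ ad ⟩
    unit (suc m) n          ≡⟨ cong₂ unit (+-comm m 1) refl ⟨
    unit (m + 1) n          ≡⟨ unit-* m 0 1 n ⟨
    unit m 0 * unit 1 n     ≡⟨ cong (λ t → unit m 0 * unit 1 t) l≡n ⟨
    unit m 0 * unit 1 l     ≡⟨ cong (unit m 0 *_) ab ⟨
    unit m 0 * (a * b + 1)  ∎
    where open ≡-Reasoning

  bc≡ : b * c + 1 ≡ unit m 0 * (a * b + 1) * r
  bc≡ = begin
    b * c + 1                     ≡⟨ bc ⟩
    unit (suc u) v                ≡⟨ cong₂ unit (trans u≡m (sym (+-identityʳ (suc m)))) (trans (sym (proj₂ w+)) (sym (+-suc n w))) ⟩
    unit (suc m + 0) (n + suc w)  ≡⟨ unit-* (suc m) n 0 (suc w) ⟨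
    unit (suc m) n * r            ≡⟨ cong (_* r) (trans (sym ad) ad≡) ⟩
    unit m 0 * (a * b + 1) * r    ∎
    where open ≡-Reasoning

  open Rigid (rigid a>0 (<⇒≤ a<c) c<d ad≡ bc≡ (unit∣edge b d bd (≤-trans (n≤1+n m) (<⇒≤ m<y)) z≤n))

  j+ : ∃[ j ] suc (suc m) + j ≡ x
  j+ = m≤n⇒∃[o]m+o≡n m<x

  -- As m + 1 < x, cancelling q = 2^m from ac + 1 = 2^x leaves at least 2².
  a²r+1≡ : a * a * r + 1 ≡ unit (2 + proj₁ j+) 0
  a²r+1≡ = *-cancelˡ-≡ _ _ (unit m 0) {{unit≢0 m 0}} (begin
    unit m 0 * (a * a * r + 1)            ≡⟨ ac+1≡ ⟨
    a * c + 1                             ≡⟨ ac ⟩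
    unit x 0                              ≡⟨ cong (λ t → unit t 0) (trans (lem m (proj₁ j+)) (proj₂ j+)) ⟨
    unit (m + (2 + proj₁ j+)) 0           ≡⟨ unit-* m 0 (2 + proj₁ j+) 0 ⟨
    unit m 0 * unit (2 + proj₁ j+) 0      ∎)
    where
    open ≡-Reasoning
    lem : ∀ m j → m + (2 + j) ≡ suc (suc m) + j
    lem = solve-∀

  -- Multiples of 8 are excluded by residues; the one remaining value 4 means a² r = 3.
  finish : ∀ j → a * a * r + 1 ≡ unit (2 + j) 0 → ⊥
  finish (suc j) eq = 8∤a²3^w+1 a (suc w)
    (subst (8 ∣_) (trans (sym eq) (cong (λ t → a * a * t + 1) (unit≡3^ (suc w))))
      (subst (_∣ unit (3 + j) 0) (unit≡2^ 3) (unit-mono-∣ (m≤m+n 3 j) z≤n)))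
  finish zero eq with a²r≡3 a w (+-cancelʳ-≡ 1 _ 3 (trans eq (unit≡2^ 2)))
  -- Now q = e + 1, 3 (e + 1) = be + 1 and d = (e + 1) b + e, so bd + 1 would be 56 or 57.
  ... | a≡1 , r≡3 = 2^≢56,57 y (trans (cong (λ t → b * t + 1) (sym d≡′)) bd) (exceptional b e (begin
      (e + 1) * 3   ≡⟨ cong₂ _*_ q≡′ r≡3 ⟨
      unit m 0 * r  ≡⟨ qr≡ ⟩
      b * e + 1     ∎))
    where
    open ≡-Reasoning
    q≡′ : unit m 0 ≡ e + 1
    q≡′ = trans q≡ (trans (cong (λ t → t * e + 1) a≡1) (cong (_+ 1) (*-identityˡ e)))
    d≡′ : d ≡ (e + 1) * b + e
    d≡′ = trans d≡ (cong (λ t → t * b + e) q≡′)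

-- The pattern and its symmetries.

Pure₂ Pure₃ Mixed : ℕ → ℕ → Set
Pure₂ x y = ∃[ i ] x * y + 1 ≡ unit i 0
Pure₃ x y = ∃[ j ] x * y + 1 ≡ unit 1 j
Mixed x y = ∃[ i ] ∃[ j ] x * y + 1 ≡ unit (suc i) j

dichotomy : ∀ {s t} → s ≢ t → s < t ⊎ t < s
dichotomy {s} {t} s≢t with <-cmp s t
... | tri< s<t _ _ = inj₁ s<t
... | tri≈ _ s≡t _ = contradiction s≡t s≢t
... | tri> _ _ t<s = inj₂ t<s

-- The six pairs form the three perfect matchings of K₄, and each matching carries one shape. The
-- Klein four-group maps every matching to itself.
record Pattern (d x y z : ℕ) : Set where
  field
    d>0 : 0 < d
    x>0 : 0 < x
    y>0 : 0 < y
    z>0 : 0 < z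
    d≢x : d ≢ x
    d≢y : d ≢ y
    d≢z : d ≢ z
    x≢y : x ≢ y
    x≢z : x ≢ z
    y≢z : y ≢ z
    dx  : Pure₂ d x
    yz  : Pure₂ y z
    dy  : Pure₃ d y
    xz  : Pure₃ x z
    dz  : Mixed d z
    xy  : Mixed x y

-- Together with `Pattern-swap₂` this generates the Klein four-group, which can bring any entry to
-- the first place.
Pattern-swap₁ : ∀ {d x y z} → Pattern d x y z → Pattern x d z y
Pattern-swap₁ {d} {x} {y} {z} p = record
  { d>0 = x>0 ; x>0 = d>0 ; y>0 = z>0 ; z>0 = y>0
  ; d≢x = ≢-sym d≢x ; d≢y = x≢z ; d≢z = x≢y ; x≢y = d≢z ; x≢z = d≢y ; y≢z = ≢-sym y≢z
  ; dx = proj₁ dx , edge-sym d x (proj₂ dx)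
  ; yz = proj₁ yz , edge-sym y z (proj₂ yz)
  ; dy = xz ; xz = dy ; dz = xy ; xy = dz }
  where open Pattern p

Pattern-swap₂ : ∀ {d x y z} → Pattern d x y z → Pattern y z d x
Pattern-swap₂ {d} {x} {y} {z} p = record
  { d>0 = y>0 ; x>0 = z>0 ; y>0 = d>0 ; z>0 = x>0
  ; d≢x = y≢z ; d≢y = ≢-sym d≢y ; d≢z = ≢-sym x≢y ; x≢y = ≢-sym d≢z ; x≢z = ≢-sym x≢z ; y≢z = d≢x
  ; dx = yz ; yz = dx
  ; dy = proj₁ dy , edge-sym d y (proj₂ dy)
  ; xz = proj₁ xz , edge-sym x z (proj₂ xz)
  ; dz = let i , j , eq = xy in i , j , edge-sym x y eq
  ; xy = let i , j , eq = dz in i , j , edge-sym d z eq }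
  where open Pattern p

-- The contradiction when d is the largest entry.

-- The divisor would divide |x - z|, which is nonzero but less than d < xd + 1.
edge∤edge : ∀ {d x z} → 0 < x → x < d → z < d → x ≢ z → ¬ x * d + 1 ∣ z * d + 1
edge∤edge {d} {x} {z} x>0 x<d z<d x≢z xd∣zd = x≢z (∣∧<⇒≡ (∣-dist x z d ∣-refl xd∣zd) (begin-strict
  ∣ x - z ∣  <⟨ ∣x-y∣<z x<d z<d ⟩
  d          ≤⟨ m≤n*m d x {{>-nonZero x>0}} ⟩
  x * d      ≤⟨ m≤m+n (x * d) 1 ⟩
  x * d + 1  ∎))
  where open ≤-Reasoning

noPattern-max : ∀ {d x y z} → Pattern d x y z → x < d → y < d → z < d → ⊥
noPattern-max {d} {x} {y} {z} pat x<d y<d z<d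
  with record { dx = p , dx ; yz = i , yz ; dy = k , dy ; xz = l , xz ; dz = m , n , dz ; xy = u , v , xy
              ; x>0 = x>0 ; y>0 = y>0 ; z>0 = z>0 ; x≢y = x≢y ; x≢z = x≢z ; y≢z = y≢z } ← pat
  = [ x<y-case , y<x-case ]′ (dichotomy x≢y)
  where
  xd = edge-sym d x dx
  yd = edge-sym d y dy
  zd = edge-sym d z dz
  zx = edge-sym x z xz
  zy = edge-sym y z yz
  yx = edge-sym x y xy

  -- Neither xd + 1 = 2^p nor yd + 1 = 2·3^k divides zd + 1, which is even; so p and k exceed the
  -- exponents of 2 and 3 in zd + 1.
  m<p : suc m < p
  m<p = ≰⇒> λ p≤m → edge∤edge x>0 x<d z<d x≢z
    (subst (_∣ z * d + 1) (sym xd) (unit∣edge z d zd p≤m z≤n))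

  n<k : n < k
  n<k = ≰⇒> λ k≤n → edge∤edge y>0 y<d z<d y≢z
    (subst (_∣ z * d + 1) (sym yd) (unit∣edge z d zd (s≤s z≤n) k≤n))

  2^m∣ : unit (suc m) 0 ∣ ∣ x - z ∣
  2^m∣ = ∣-dist x z d (unit∣edge x d xd (<⇒≤ m<p) z≤n) (unit∣edge z d zd ≤-refl z≤n)

  2·3^n∣ : unit 1 n ∣ ∣ y - z ∣
  2·3^n∣ = ∣-dist y z d (unit∣edge y d yd ≤-refl (<⇒≤ n<k))
                        (unit∣edge z d zd (s≤s z≤n) ≤-refl)

  dist≢0 : ∀ {s t} → s ≢ t → NonZero ∣ s - t ∣
  dist≢0 s≢t = ≢-nonZero (s≢t ∘ ∣m-n∣≡0⇒m≡n)

  2^m≤ : unit (suc m) 0 ≤ ∣ x - z ∣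
  2^m≤ = ∣⇒≤ {{dist≢0 x≢z}} 2^m∣

  2·3^n≤ : unit 1 n ≤ ∣ y - z ∣
  2·3^n≤ = ∣⇒≤ {{dist≢0 y≢z}} 2·3^n∣

  -- The two lower bounds multiply to 2^(m+2)·3^n, twice zd + 1.
  zd<dist*dist : z * d < ∣ x - z ∣ * ∣ y - z ∣
  zd<dist*dist = begin-strict
    z * d                          <⟨ m<m+n (z * d) (s≤s z≤n) ⟩
    z * d + 1                      ≡⟨ zd ⟩
    unit (suc m) n                 ≤⟨ unit-mono-≤ {suc m} {n} {suc m + 1} {n} (m≤m+n (suc m) 1) ≤-refl ⟩
    unit (suc m + 1) n             ≡⟨ unit-* (suc m) 0 1 n ⟨
    unit (suc m) 0 * unit 1 n      ≤⟨ *-mono-≤ 2^m≤ 2·3^n≤ ⟩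
    ∣ x - z ∣ * ∣ y - z ∣          ∎
    where open ≤-Reasoning

  dist≤ : ∀ {s t} → s ≤ t → ∣ s - t ∣ ≤ t
  dist≤ {s} {t} s≤t = subst (_≤ t) (sym (m≤n⇒∣m-n∣≡n∸m s≤t)) (m∸n≤m t s)

  dist< : ∀ {s t} → 0 < t → t < s → ∣ s - t ∣ < s
  dist< {s} {t} t>0 t<s = subst (_< s) (sym (m≤n⇒∣n-m∣≡n∸m (<⇒≤ t<s)))
    (∸-monoʳ-< t>0 (<⇒≤ t<s))

  -- If x ≤ z, then |x - z| ≤ z and |y - z| < d, so the product could not exceed zd.
  z<x : z < x
  z<x = ≰⇒> λ x≤z → <⇒≱ zd<dist*dist (*-mono-≤ (dist≤ x≤z) (<⇒≤ (∣x-y∣<z y<d z<d)))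

  z<y : z < y
  z<y = ≰⇒> λ y≤z → <⇒≱ zd<dist*dist
    (subst (∣ x - z ∣ * ∣ y - z ∣ ≤_) (*-comm d z) (*-mono-≤ (<⇒≤ (∣x-y∣<z x<d z<d)) (dist≤ y≤z)))

  zd<xy : z * d < x * y
  zd<xy = <-≤-trans zd<dist*dist (*-mono-≤ (<⇒≤ (dist< z>0 z<x)) (<⇒≤ (dist< z>0 z<y)))

  -- z takes the place of a, and the smaller of x and y that of b; the shape of bd + 1 decides which
  -- case applies.
  x<y-case : x < y → ⊥
  x<y-case x<y = no-bd-pure₂ {x = i} {y = p} {k} {l} {m} {n} {u} {v} z>0 z<y x<y y<d xd zy yd zx zd xy m<p n<k
    (≤-<-trans 2^m≤ (dist< z>0 z<x)) zd<xy

  y<x-case : y < x → ⊥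
  y<x-case y<x = no-bd-pure₃ {x = i} {y = p} {k} {l} {m} {n} {u} {v} z>0 z<x y<x x<d xd zy yd zx zd yx m<p n<k
    (≤-<-trans 2·3^n≤ (dist< z>0 z<y)) (subst (z * d <_) (*-comm x y) zd<xy)

-- The larger of d, x is compared with the larger of y, z, and a symmetry moves the overall maximum
-- to the first place.
noPattern : ∀ {d x y z} → ¬ Pattern d x y z
noPattern {d} {x} {y} {z} pat = cases (dichotomy d≢x) (dichotomy y≢z)
  where
  open Pattern pat

  cases : d < x ⊎ x < d → y < z ⊎ z < y → ⊥
  cases (inj₁ d<x) (inj₁ y<z) with dichotomy x≢z
  ... | inj₁ x<z = noPattern-max (Pattern-swap₁ (Pattern-swap₂ pat)) y<z x<z (<-trans d<x x<z)
  ... | inj₂ z<x = noPattern-max (Pattern-swap₁ pat) d<x z<x (<-trans y<z z<x)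
  cases (inj₁ d<x) (inj₂ z<y) with dichotomy x≢y
  ... | inj₁ x<y = noPattern-max (Pattern-swap₂ pat) z<y (<-trans d<x x<y) x<y
  ... | inj₂ y<x = noPattern-max (Pattern-swap₁ pat) d<x (<-trans z<y y<x) y<x
  cases (inj₂ x<d) (inj₁ y<z) with dichotomy d≢z
  ... | inj₁ d<z = noPattern-max (Pattern-swap₁ (Pattern-swap₂ pat)) y<z (<-trans x<d d<z) d<z
  ... | inj₂ z<d = noPattern-max pat x<d (<-trans y<z z<d) z<d
  cases (inj₂ x<d) (inj₂ z<y) with dichotomy d≢y
  ... | inj₁ d<y = noPattern-max (Pattern-swap₂ pat) z<y d<y (<-trans x<d d<y)
  ... | inj₂ y<d = noPattern-max pat x<d y<d (<-trans z<y y<d)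

-- The pattern modulo 12.

res : ℕ → ℕ → ℕ
res x y = (x * y + 1) % 12

res-% : ∀ x y → res (x % 12) (y % 12) ≡ res x y
res-% x y = begin
  (x % 12 * (y % 12) + 1) % 12         ≡⟨ %-distribˡ-+ (x % 12 * (y % 12)) 1 12 ⟩
  ((x % 12 * (y % 12)) % 12 + 1) % 12  ≡⟨ cong (λ t → (t + 1) % 12) (%-distribˡ-* x y 12) ⟨
  ((x * y) % 12 + 1) % 12              ≡⟨ %-distribˡ-+ (x * y) 1 12 ⟨
  (x * y + 1) % 12                     ∎
  where open ≡-Reasoning

-- Residue 8 excludes the factor 3; residue 6 excludes 4 but keeps 2; residue 0 keeps 2. For
-- {2,3}-units these yield `Pure₂`, `Pure₃` and `Mixed`.
Layout : (d x y z : ℕ) → Set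
Layout d x y z = res d x ≡ 8 × res y z ≡ 8 × res d y ≡ 6 × res x z ≡ 6 × res d z ≡ 0 × res x y ≡ 0

layout? : ∀ d x y z → Dec (Layout d x y z)
layout? d x y z = res d x ≟ 8 ×-dec res y z ≟ 8 ×-dec res d y ≟ 6 ×-dec res x z ≟ 6 ×-dec res d z ≟ 0 ×-dec res x y ≟ 0

layout-% : ∀ d x y z → Layout (d % 12) (x % 12) (y % 12) (z % 12) → Layout d x y z
layout-% d x y z (dx , yz , dy , xz , dz , xy) =
  via d x dx , via y z yz , via d y dy , via x z xz , via d z dz , via x y xy
  where
  via : ∀ s t {ρ} → res (s % 12) (t % 12) ≡ ρ → res s t ≡ ρ
  via s t = trans (sym (res-% s t))

-- For distinct positive x, y, xy + 1 exceeds 2, so a {2,3}-unit of this form is divisible by 4 or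
-- by 3. As 4 and 3 divide 12, the residue shows this.
Good : ℕ → Set
Good ρ = 4 ∣ ρ ⊎ 3 ∣ ρ

good? : ∀ ρ → Dec (Good ρ)
good? ρ = 4 ∣? ρ ⊎-dec 3 ∣? ρ

-- An exhaustive check. Up to the Klein four-group the 24 orderings reduce to 6, so p can stay
-- first. Each hypothesis comes as early as possible, so that the search drops bad pairs and triples
-- before ranging over the next residue.
layout-exists : ∀ {p} → p < 12 → ∀ {q} → q < 12 → Good (res p q) →
                ∀ {r} → r < 12 → Good (res p r) → Good (res q r) →
                ∀ {s} → s < 12 → Good (res p s) → Good (res q s) → Good (res r s) →
                Layout p q r s ⊎ Layout p q s r ⊎ Layout p r q s ⊎ Layout p r s q ⊎ Layout p s q r ⊎ Layout p s r q
layout-exists = from-yes (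
  allUpTo? (λ p → allUpTo? (λ q → good? (res p q) →-dec
  allUpTo? (λ r → good? (res p r) →-dec good? (res q r) →-dec
  allUpTo? (λ s → good? (res p s) →-dec good? (res q s) →-dec good? (res r s) →-dec
    (layout? p q r s ⊎-dec layout? p q s r ⊎-dec layout? p r q s ⊎-dec layout? p r s q ⊎-dec layout? p s q r ⊎-dec layout? p s r q))
  12) 12) 12) 12)

-- From residues back to exponents.

module _ (x y : ℕ) (xy : IsSUnit S23 (x * y + 1)) where
  private
    i = proj₁ (SUnit⇒unit xy)
    j = proj₁ (proj₂ (SUnit⇒unit xy))
    eq : x * y + 1 ≡ unit i j
    eq = proj₂ (proj₂ (SUnit⇒unit xy))

    ∣res : ∀ {g i′ j′} → g ∣ 12 → unit i′ j′ ≡ g → i′ ≤ i → j′ ≤ j → g ∣ res x y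
    ∣res g∣12 refl i′≤i j′≤j = %-presˡ-∣ (unit∣edge x y eq i′≤i j′≤j) g∣12

    2∣res⇒1≤i : 2 ∣ res x y → 1 ≤ i
    2∣res⇒1≤i 2∣ = unit∣⇒≤₂ {1} {0} {i} {j} (subst₂ _∣_ (sym (unit≡2^ 1)) eq (∣n∣m%n⇒∣m (divides 6 refl) 2∣))

  good : 0 < x → 0 < y → x ≢ y → Good (res x y)
  good x>0 y>0 x≢y with 2 ≤? i | 1 ≤? j
  ... | yes 2≤i | _       = inj₁ (∣res (divides 3 refl) (unit≡2^ 2) 2≤i z≤n)
  ... | no  _   | yes 1≤j = inj₂ (∣res (divides 4 refl) (unit≡3^ 1) z≤n 1≤j)
  ... | no  2≰i | no  1≰j = contradiction (subst₂ _≤_ (sym eq) (unit≡2^ 1) (unit-mono-≤ (m<1+n⇒m≤n (≰⇒> 2≰i)) (m<1+n⇒m≤n (≰⇒> 1≰j)))) (big x y x>0 y>0 x≢y)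
    where
    big : ∀ x y → 0 < x → 0 < y → x ≢ y → ¬ x * y + 1 ≤ 2
    big x y x>0 y>0 x≢y xy+1≤2 = x≢y (trans (m*n≡1⇒m≡1 x y xy≡1) (sym (m*n≡1⇒n≡1 x y xy≡1)))
      where
      xy≡1 : x * y ≡ 1
      xy≡1 = ≤-antisym (+-cancelʳ-≤ 1 (x * y) 1 xy+1≤2) (*-mono-≤ x>0 y>0)

  pure₂ : res x y ≡ 8 → Pure₂ x y
  pure₂ ρ≡8 = i , subst (λ t → x * y + 1 ≡ unit i t) j≡0 eq
    where
    j≡0 : j ≡ 0
    -- A factor 3 of xy + 1 would survive reduction modulo 12 and divide 8.
    j≡0 = n<1⇒n≡0 (≰⇒> λ 1≤j → from-no (3 ∣? 8) (subst (3 ∣_) ρ≡8 (∣res (divides 4 refl) (unit≡3^ 1) z≤n 1≤j)))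

  pure₃ : res x y ≡ 6 → Pure₃ x y
  pure₃ ρ≡6 = j , subst (λ t → x * y + 1 ≡ unit t j) i≡1 eq
    where
    i≡1 : i ≡ 1
    i≡1 = ≤-antisym
      (≮⇒≥ λ 2≤i → from-no (4 ∣? 6) (subst (4 ∣_) ρ≡6 (∣res (divides 3 refl) (unit≡2^ 2) 2≤i z≤n)))
      (2∣res⇒1≤i (subst (2 ∣_) (sym ρ≡6) (divides 3 refl)))

  mixed : res x y ≡ 0 → Mixed x y
  mixed ρ≡0 with m≤n⇒∃[o]m+o≡n (2∣res⇒1≤i (subst (2 ∣_) (sym ρ≡0) (2 ∣0)))
  ... | i′ , 1+i′≡i = i′ , j , trans eq (cong (λ t → unit t j) (sym 1+i′≡i))

-- Conclusion for quadruples.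

theorem3 : (a : Fin 4 → ℕ) → ¬ IsSDiophantineQuadruple S23 a
theorem3 a (a>0 , a≢ , a-unit) =
  [ noLayout 0F 1F 2F 3F (λ ()) (λ ()) (λ ()) (λ ()) (λ ()) (λ ())
  , [ noLayout 0F 1F 3F 2F (λ ()) (λ ()) (λ ()) (λ ()) (λ ()) (λ ())
  , [ noLayout 0F 2F 1F 3F (λ ()) (λ ()) (λ ()) (λ ()) (λ ()) (λ ())
  , [ noLayout 0F 2F 3F 1F (λ ()) (λ ()) (λ ()) (λ ()) (λ ()) (λ ())
  , [ noLayout 0F 3F 1F 2F (λ ()) (λ ()) (λ ()) (λ ()) (λ ()) (λ ())
  , noLayout 0F 3F 2F 1F (λ ()) (λ ()) (λ ()) (λ ()) (λ ()) (λ ())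
  ]′ ]′ ]′ ]′ ]′
  (layout-exists (<12 0F) (<12 1F) (g 0F 1F λ ()) (<12 2F) (g 0F 2F λ ()) (g 1F 2F λ ())
                 (<12 3F) (g 0F 3F λ ()) (g 1F 3F λ ()) (g 2F 3F λ ()))
  where
  <12 : ∀ i → a i % 12 < 12
  <12 i = m%n<n (a i) 12

  g : ∀ i j → i ≢ j → Good (res (a i % 12) (a j % 12))
  g i j i≢j = subst Good (sym (res-% (a i) (a j))) (good (a i) (a j) (a-unit i j i≢j) (a>0 i) (a>0 j) (a≢ i j i≢j))

  noLayout : ∀ i j k l → i ≢ j → i ≢ k → i ≢ l → j ≢ k → j ≢ l → k ≢ l →
             ¬ Layout (a i % 12) (a j % 12) (a k % 12) (a l % 12)
  noLayout i j k l i≢j i≢k i≢l j≢k j≢l k≢l lay =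
    let ij , kl , ik , jl , il , jk = layout-% (a i) (a j) (a k) (a l) lay in
    noPattern record
      { d>0 = a>0 i ; x>0 = a>0 j ; y>0 = a>0 k ; z>0 = a>0 l
      ; d≢x = a≢ i j i≢j ; d≢y = a≢ i k i≢k ; d≢z = a≢ i l i≢l
      ; x≢y = a≢ j k j≢k ; x≢z = a≢ j l j≢l ; y≢z = a≢ k l k≢l
      ; dx = pure₂ (a i) (a j) (a-unit i j i≢j) ij ; yz = pure₂ (a k) (a l) (a-unit k l k≢l) kl
      ; dy = pure₃ (a i) (a k) (a-unit i k i≢k) ik ; xz = pure₃ (a j) (a l) (a-unit j l j≢l) jl
      ; dz = mixed (a i) (a l) (a-unit i l i≢l) il ; xy = mixed (a j) (a k) (a-unit j k j≢k) jk }
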